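{- For every bunch of formulae $\Gamma \in \mathcal{B}(\mathbb{F})$ and every formula $\varphi \in \mathbb{F}$: if $\Gamma \vdash \varphi$ (i.e. the sequent $\Gamma \triangleright \varphi$ is provable in the natural deduction system $\mathsf{NBI}$), then $\Gamma \Vdash \varphi$ (i.e. the sequent $\Gamma\triangleright\varphi$ is valid in the base-extension semantics).
   Context: **Syntax.** Fix a denumerable (countably infinite) set $\mathbb{A}$ of atoms. The set $\mathbb{F}$ of formulae of the logic of bunched implications (BI) is generated by $\varphi ::= p\in\mathbb{A} \mid \top \mid \bot \mid \top^{\ast} \mid \varphi\land\varphi \mid \varphi\lor\varphi \mid \varphi\to\varphi \mid \varphi\ast\varphi \mid \varphi\mathbin{ -\!\ast}\varphi$. For a set $X$, the set $\mathcal{B}(X)$ of bunches over $X$ is generated by $\Gamma ::= x\in X \mid \varnothing_{+} \mid \varnothing_{\times} \mid (\Gamma ; \Gamma) \mid (\Gamma , \Gamma)$; here $;$ is the additive context-former with unit $\varnothing_+$, and $,$ is the multiplicative context-former with unit $\varnothing_\times$. $\Gamma(\Delta)$ denotes a bunch with a distinguished sub-bunch occurrence $\Delta$, and $\Gamma(\Delta')$ the result of replacing that occurrence by $\Delta'$. A contextual bunch over $X$ is a function $\mathcal{B}(X)\to\mathcal{B}(X)$ of the form $\Sigma\mapsto\Gamma(\Sigma)$ (equivalently, a bunch with exactly one hole), written $\Gamma(\cdot)$; the set of these is $\dot{\mathcal{B}}(X)$, and $(\cdot)$ denotes the identity. Coherent equivalence $\equiv$ is the least equivalence relation on $\mathcal{B}(X)$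 containing the commutative monoid equations for $;$ with unit $\varnothing_+$ and for $,$ with unit $\varnothing_\times$, and such that $\Delta\equiv\Delta'$ implies $\Gamma(\Delta)\equiv\Gamma(\Delta')$. **System $\mathsf{NBI}$.** A sequent is a pair $\Gamma\triangleright\varphi$ with $\Gamma\in\mathcal{B}(\mathbb{F})$, $\varphi\in\mathbb{F}$. $\Gamma\vdash\varphi$ means $\Gamma\triangleright\varphi$ is derivable by the rules (premisses $\Rightarrow$ conclusion): $\Rightarrow \varphi\triangleright\varphi$; $\Gamma'\triangleright\varphi \Rightarrow \Gamma\triangleright\varphi$ if $\Gamma\equiv\Gamma'$; $\Gamma(\Delta)\triangleright\varphi \Rightarrow \Gamma(\Delta;\Delta')\triangleright\varphi$; $\Gamma(\Delta;\Delta)\triangleright\varphi \Rightarrow \Gamma(\Delta)\triangleright\varphi$; $\Rightarrow \varnothing_\times\triangleright\top^\ast$; [$\Gamma(\varnothing_\times)\triangleright\chi$ and $\Delta\triangleright\top^\ast$] $\Rightarrow \Gamma(\Delta)\triangleright\chi$; $(\Gamma,\varphi)\triangleright\psi \Rightarrow \Gamma\triangleright\varphi\mathbin{ -\!\ast}\psi$; [$\Gamma\triangleright\varphi\mathbin{ -\!\ast}\psi$ and $\Delta\triangleright\varphi$] $\Rightarrow (\Gamma,\Delta)\triangleright\psi$; [$\Gamma\triangleright\varphi$ and $\Delta\triangleright\psi$] $\Rightarrow (\Gamma,\Delta)\triangleright\varphi\ast\psi$; [$\Gamma(\varphi,\psi)\triangleright\chi$ and $\Delta\triangleright\varphi\ast\psi$]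 $\Rightarrow \Gamma(\Delta)\triangleright\chi$; $\Rightarrow \varnothing_+\triangleright\top$; [$\Gamma(\varnothing_+)\triangleright\chi$ and $\Delta\triangleright\top$] $\Rightarrow \Gamma(\Delta)\triangleright\chi$; $(\Gamma;\varphi)\triangleright\psi \Rightarrow \Gamma\triangleright\varphi\to\psi$; [$\Gamma\triangleright\varphi\to\psi$ and $\Delta\triangleright\varphi$] $\Rightarrow (\Gamma;\Delta)\triangleright\psi$; [$\Gamma\triangleright\varphi$ and $\Delta\triangleright\psi$] $\Rightarrow (\Gamma;\Delta)\triangleright\varphi\land\psi$; [$\Gamma(\varphi;\psi)\triangleright\chi$ and $\Delta\triangleright\varphi\land\psi$] $\Rightarrow \Gamma(\Delta)\triangleright\chi$; $\Gamma\triangleright\varphi_i \Rightarrow \Gamma\triangleright\varphi_1\lor\varphi_2$ ($i\in\{1,2\}$); [$\Gamma(\varphi)\triangleright\chi$ and $\Gamma(\psi)\triangleright\chi$ and $\Delta\triangleright\varphi\lor\psi$] $\Rightarrow \Gamma(\Delta)\triangleright\chi$; $\Gamma\triangleright\bot \Rightarrow \Gamma\triangleright\varphi$. **Bases.** An atomic rule is a pair consisting of a finite (possibly empty) set of premisses $P_1\triangleright p_1,\dots,P_n\triangleright p_n$ and a conclusion $P\triangleright p$, with $P_i,P\in\mathcal{B}(\mathbb{A})$, $p_i,p\in\mathbb{A}$; rules are not closed under substitution. A base is a set of atomic rules; $\mathscr{C}$ extends $\mathscr{B}$ when $\mathscr{C}\supseteq\mathscr{B}$. Derivability $\vdash_{\mathscr{B}}$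 is the smallest relation between $\mathcal{B}(\mathbb{A})$ and $\mathbb{A}$ such that: $p\vdash_{\mathscr{B}}p$; if a rule of $\mathscr{B}$ has premisses $P_i\triangleright p_i$ ($i=1,\dots,n$, $n\ge 0$) and conclusion $P\triangleright p$, and $P_i\vdash_{\mathscr{B}}p_i$ for all $i$, then $P\vdash_{\mathscr{B}}p$; if $P(Q)\vdash_{\mathscr{B}}p$ then $P(Q;Q')\vdash_{\mathscr{B}}p$ for any $Q'\in\mathcal{B}(\mathbb{A})$; if $P(Q;Q)\vdash_{\mathscr{B}}p$ then $P(Q)\vdash_{\mathscr{B}}p$; if $P(Q)\vdash_{\mathscr{B}}p$ and $Q\equiv Q'$ then $P(Q')\vdash_{\mathscr{B}}p$; if $T\vdash_{\mathscr{B}}q$ and $S(q)\vdash_{\mathscr{B}}p$ then $S(T)\vdash_{\mathscr{B}}p$. **Bunch-extension.** $\succeq$ is the least transitive relation on bunches such that $\Gamma\succeq\Gamma'$ whenever $\Gamma$ is coherently equivalent to the result of replacing some sub-bunch occurrence $\Delta$ of $\Gamma'$ by $(\Delta;\Delta')$, for some bunch $\Delta'$. $\Gamma'\preceq\Gamma$ means $\Gamma\succeq\Gamma'$. **Support.** For a base $\mathscr{B}$, $S\in\mathcal{B}(\mathbb{A})$ and $R(\cdot)\in\dot{\mathcal{B}}(\mathbb{A})$, support of formulae, of bunches of formulae, and of sequents is defined inductively ($\mathscr{X}$ ranges over bases, $U(\cdot)$ over $\dot{\mathcal{B}}(\mathbb{A})$, $U,Q_1,Q_2$ over $\mathcal{B}(\mathbb{A})$,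 $p$ over $\mathbb{A}$): - $\Vdash^{S}_{\mathscr{B}}p$ iff $S\vdash_{\mathscr{B}}p$; - $\Vdash^{S}_{\mathscr{B}}\varphi\land\psi$ iff for all $\mathscr{X}\supseteq\mathscr{B}$, $U(\cdot)$, $p$: if $(\varphi;\psi)\Vdash^{U(\cdot)}_{\mathscr{X}}p$ then $\Vdash^{U(S)}_{\mathscr{X}}p$; - $\Vdash^{S}_{\mathscr{B}}\varphi\ast\psi$ iff for all $\mathscr{X}\supseteq\mathscr{B}$, $U(\cdot)$, $p$: if $(\varphi,\psi)\Vdash^{U(\cdot)}_{\mathscr{X}}p$ then $\Vdash^{U(S)}_{\mathscr{X}}p$; - $\Vdash^{S}_{\mathscr{B}}\varphi\lor\psi$ iff for all $\mathscr{X}\supseteq\mathscr{B}$, $U(\cdot)$, $p$: if $\varphi\Vdash^{U(\cdot)}_{\mathscr{X}}p$ and $\psi\Vdash^{U(\cdot)}_{\mathscr{X}}p$ then $\Vdash^{U(S)}_{\mathscr{X}}p$; - $\Vdash^{S}_{\mathscr{B}}\varphi\to\psi$ iff $\varphi\Vdash^{S;(\cdot)}_{\mathscr{B}}\psi$; - $\Vdash^{S}_{\mathscr{B}}\varphi\mathbin{ -\!\ast}\psi$ iff $\varphi\Vdash^{S,(\cdot)}_{\mathscr{B}}\psi$; - $\Vdash^{S}_{\mathscr{B}}\bot$ iff for all $U(\cdot)$ and $p$: $\Vdash^{U(S)}_{\mathscr{B}}p$; - $\Vdash^{S}_{\mathscr{B}}\top$ iff for all $\mathscr{X}\supseteq\mathscr{B}$,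 $U(\cdot)$, $p$: if $\Vdash^{U(\varnothing_+)}_{\mathscr{X}}p$ then $\Vdash^{U(S)}_{\mathscr{X}}p$; - $\Vdash^{S}_{\mathscr{B}}\top^\ast$ iff for all $\mathscr{X}\supseteq\mathscr{B}$, $U(\cdot)$, $p$: if $\Vdash^{U(\varnothing_\times)}_{\mathscr{X}}p$ then $\Vdash^{U(S)}_{\mathscr{X}}p$; - $\Gamma\Vdash^{R(\cdot)}_{\mathscr{B}}\psi$ iff for all $\mathscr{X}\supseteq\mathscr{B}$ and $U$: if $\Vdash^{U}_{\mathscr{X}}\Gamma$ then $\Vdash^{R(U)}_{\mathscr{X}}\psi$; - $\Vdash^{S}_{\mathscr{B}}\varnothing_\times$ iff $S\succeq\varnothing_\times$; - $\Vdash^{S}_{\mathscr{B}}\varnothing_+$ always; - $\Vdash^{S}_{\mathscr{B}}(\Gamma,\Delta)$ iff there are $Q_1,Q_2$ with $S\succeq(Q_1,Q_2)$, $\Vdash^{Q_1}_{\mathscr{B}}\Gamma$ and $\Vdash^{Q_2}_{\mathscr{B}}\Delta$; - $\Vdash^{S}_{\mathscr{B}}(\Gamma;\Delta)$ iff there are $Q_1,Q_2$ with $S\succeq Q_1$, $S\succeq Q_2$, $\Vdash^{Q_1}_{\mathscr{B}}\Gamma$ and $\Vdash^{Q_2}_{\mathscr{B}}\Delta$. **Validity.** $\Gamma\Vdash\varphi$ iff $\Gamma\Vdash^{(\cdot)}_{\mathscr{B}}\varphi$ for every base $\mathscr{B}$. -}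

module Defs where

open import Level using (Lift; 0ℓ; suc)
open import Data.List.Base using (List)
open import Data.List.Relation.Unary.All using (All)
open import Data.Product.Base using (_×_; ∃-syntax)
open import Data.Unit.Polymorphic.Base using () renaming (⊤ to Unit)
open import Relation.Binary.Construct.Closure.Transitive using (TransClosure)
open import Relation.Binary.Core using (Rel)
open import Relation.Binary.PropositionalEquality.Core using (_≡_; refl)
open import Relation.Unary using (Pred; _∈_; _⊆_)

infixr 8 _∗_
infixr 7 _∧_
infixr 6 _∨_
infixr 5 _⇒_ _─∗_
infixr 4 _⸴_ _⸴ˡ_ _⸴ʳ_
infixr 3 _⨟_ _⨟ˡ_ _⨟ʳ_
infix  9 _[_]
infix  2 _≋_ _⪰₁_ _⪰_ _▷_
infix  1 _⊢_ ⟨_⟩_⊢ₐ_ _⊩⟨_∣_⟩_ _⊨_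

private variable
  A X : Set

------------------------------------------------------------------------
-- Formulae, bunches, contextual bunches

data Formula (A : Set) : Set where
  atom              : A → Formula A
  ⊤ ⊥ ⊤*            : Formula A
  _∧_ _∨_ _⇒_       : Formula A → Formula A → Formula A
  _∗_ _─∗_          : Formula A → Formula A → Formula A

-- The additive context-former is ⨟ (unit ∅₊), the multiplicative one
-- is ⸴ (unit ∅ₓ).
data Bunch (X : Set) : Set where
  leaf    : X → Bunch X
  ∅₊ ∅ₓ   : Bunch X
  _⨟_ _⸴_ : Bunch X → Bunch X → Bunch X

-- Bunches with exactly one hole; ○ is the identity (·), and ˡ / ʳ say on
-- which side the hole lies.
data Ctx (X : Set) : Set where
  ○         : Ctx X
  _⨟ˡ_ _⸴ˡ_ : Ctx X → Bunch X → Ctx X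
  _⨟ʳ_ _⸴ʳ_ : Bunch X → Ctx X → Ctx X

_[_] : Ctx X → Bunch X → Bunch X
○        [ Σ ] = Σ
(C ⨟ˡ Δ) [ Σ ] = C [ Σ ] ⨟ Δ
(C ⸴ˡ Δ) [ Σ ] = C [ Σ ] ⸴ Δ
(Δ ⨟ʳ C) [ Σ ] = Δ ⨟ C [ Σ ]
(Δ ⸴ʳ C) [ Σ ] = Δ ⸴ C [ Σ ]

-- Coherent equivalence
data _≋_ {X : Set} : Rel (Bunch X) 0ℓ where
  ≋-refl      : ∀ {Γ} → Γ ≋ Γ
  ≋-sym       : ∀ {Γ Δ} → Γ ≋ Δ → Δ ≋ Γ
  ≋-trans     : ∀ {Γ Δ Θ} → Γ ≋ Δ → Δ ≋ Θ → Γ ≋ Θ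
  ⨟-assoc     : ∀ {Γ Δ Θ} → (Γ ⨟ Δ) ⨟ Θ ≋ Γ ⨟ (Δ ⨟ Θ)
  ⨟-comm      : ∀ {Γ Δ} → Γ ⨟ Δ ≋ Δ ⨟ Γ
  ⨟-identityʳ : ∀ {Γ} → Γ ⨟ ∅₊ ≋ Γ
  ⸴-assoc     : ∀ {Γ Δ Θ} → (Γ ⸴ Δ) ⸴ Θ ≋ Γ ⸴ (Δ ⸴ Θ)
  ⸴-comm      : ∀ {Γ Δ} → Γ ⸴ Δ ≋ Δ ⸴ Γ
  ⸴-identityʳ : ∀ {Γ} → Γ ⸴ ∅ₓ ≋ Γ
  ≋-cong      : ∀ (C : Ctx X) {Δ Δ′} → Δ ≋ Δ′ → C [ Δ ] ≋ C [ Δ′ ]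

-- Bunch-extension
data _⪰₁_ {X : Set} : Rel (Bunch X) 0ℓ where
  extend : ∀ {Γ} (C : Ctx X) Δ Δ′ → Γ ≋ C [ Δ ⨟ Δ′ ] → Γ ⪰₁ C [ Δ ]

_⪰_ : Rel (Bunch X) 0ℓ
_⪰_ = TransClosure _⪰₁_

------------------------------------------------------------------------
-- The system NBI

data _⊢_ {A : Set} : Bunch (Formula A) → Formula A → Set where
  ax  : ∀ {φ} → leaf φ ⊢ φ
  ex  : ∀ {Γ Γ′ φ} → Γ ≋ Γ′ → Γ′ ⊢ φ → Γ ⊢ φ
  wk  : ∀ C {Δ Δ′ φ} → C [ Δ ] ⊢ φ → C [ Δ ⨟ Δ′ ] ⊢ φ
  ct  : ∀ C {Δ φ} → C [ Δ ⨟ Δ ] ⊢ φ → C [ Δ ] ⊢ φ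

  ⊤*I : ∅ₓ ⊢ ⊤*
  ⊤*E : ∀ C {Δ χ} → C [ ∅ₓ ] ⊢ χ → Δ ⊢ ⊤* → C [ Δ ] ⊢ χ
  ─∗I : ∀ {Γ φ ψ} → Γ ⸴ leaf φ ⊢ ψ → Γ ⊢ φ ─∗ ψ
  ─∗E : ∀ {Γ Δ φ ψ} → Γ ⊢ φ ─∗ ψ → Δ ⊢ φ → Γ ⸴ Δ ⊢ ψ
  ∗I  : ∀ {Γ Δ φ ψ} → Γ ⊢ φ → Δ ⊢ ψ → Γ ⸴ Δ ⊢ φ ∗ ψ
  ∗E  : ∀ C {Δ φ ψ χ} → C [ leaf φ ⸴ leaf ψ ] ⊢ χ → Δ ⊢ φ ∗ ψ → C [ Δ ] ⊢ χ

  ⊤I  : ∅₊ ⊢ ⊤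
  ⊤E  : ∀ C {Δ χ} → C [ ∅₊ ] ⊢ χ → Δ ⊢ ⊤ → C [ Δ ] ⊢ χ
  ⇒I  : ∀ {Γ φ ψ} → Γ ⨟ leaf φ ⊢ ψ → Γ ⊢ φ ⇒ ψ
  ⇒E  : ∀ {Γ Δ φ ψ} → Γ ⊢ φ ⇒ ψ → Δ ⊢ φ → Γ ⨟ Δ ⊢ ψ
  ∧I  : ∀ {Γ Δ φ ψ} → Γ ⊢ φ → Δ ⊢ ψ → Γ ⨟ Δ ⊢ φ ∧ ψ
  ∧E  : ∀ C {Δ φ ψ χ} → C [ leaf φ ⨟ leaf ψ ] ⊢ χ → Δ ⊢ φ ∧ ψ → C [ Δ ] ⊢ χ

  ∨I₁ : ∀ {Γ φ ψ} → Γ ⊢ φ → Γ ⊢ φ ∨ ψ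
  ∨I₂ : ∀ {Γ φ ψ} → Γ ⊢ ψ → Γ ⊢ φ ∨ ψ
  ∨E  : ∀ C {Δ φ ψ χ} →
        C [ leaf φ ] ⊢ χ → C [ leaf ψ ] ⊢ χ → Δ ⊢ φ ∨ ψ → C [ Δ ] ⊢ χ
  ⊥E  : ∀ {Γ φ} → Γ ⊢ ⊥ → Γ ⊢ φ

------------------------------------------------------------------------
-- Bases

record Sequent (X : Set) : Set where
  constructor _▷_
  field
    antecedent : Bunch X
    succedent  : X

open Sequent

-- The finite set of premisses is given by a list; order and repetition
-- are invisible to derivability.
record AtomicRule (A : Set) : Set where
  constructor rule
  field
    premisses  : List (Sequent A)
    conclusion : Sequent A

Base : Set → Set₁
Base A = Pred (AtomicRule A) 0ℓ

data ⟨_⟩_⊢ₐ_ {A : Set} (𝓑 : Base A) : Bunch A → A → Set where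
  taut : ∀ {p} → ⟨ 𝓑 ⟩ leaf p ⊢ₐ p
  app  : ∀ {ss P p} → rule ss (P ▷ p) ∈ 𝓑 →
         All (λ s → ⟨ 𝓑 ⟩ antecedent s ⊢ₐ succedent s) ss → ⟨ 𝓑 ⟩ P ⊢ₐ p
  weak : ∀ C {Q Q′ p} → ⟨ 𝓑 ⟩ C [ Q ] ⊢ₐ p → ⟨ 𝓑 ⟩ C [ Q ⨟ Q′ ] ⊢ₐ p
  cont : ∀ C {Q p} → ⟨ 𝓑 ⟩ C [ Q ⨟ Q ] ⊢ₐ p → ⟨ 𝓑 ⟩ C [ Q ] ⊢ₐ p
  exch : ∀ C {Q Q′ p} → ⟨ 𝓑 ⟩ C [ Q ] ⊢ₐ p → Q ≋ Q′ → ⟨ 𝓑 ⟩ C [ Q′ ] ⊢ₐ p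
  cut  : ∀ C {T p q} → ⟨ 𝓑 ⟩ T ⊢ₐ q → ⟨ 𝓑 ⟩ C [ leaf q ] ⊢ₐ p →
         ⟨ 𝓑 ⟩ C [ T ] ⊢ₐ p

------------------------------------------------------------------------
-- Support

-- Quantifying over all bases puts support in Set₁.
Support : Set → Set₂
Support A = Base A → Bunch A → Set₁

atomS : A → Support A
atomS p 𝓑 S = Lift (suc 0ℓ) (⟨ 𝓑 ⟩ S ⊢ₐ p)

-- The clauses for Γ ⸴ Δ, Γ ⨟ Δ and Γ ⊩ ψ as operations on support
-- predicates.  The bunch φ ⨟ ψ is not a subterm of the formula φ ∧ ψ, so
-- a direct transcription of the simultaneous recursion on formulae and
-- bunches would not pass the termination checker.
_⸴ˢ_ _⨟ˢ_ : Support A → Support A → Support A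
(F ⸴ˢ G) 𝓑 S = ∃[ Q₁ ] ∃[ Q₂ ] (S ⪰ (Q₁ ⸴ Q₂)) × F 𝓑 Q₁ × G 𝓑 Q₂
(F ⨟ˢ G) 𝓑 S = ∃[ Q₁ ] ∃[ Q₂ ] (S ⪰ Q₁) × (S ⪰ Q₂) × F 𝓑 Q₁ × G 𝓑 Q₂

Entails : Support A → Base A → Ctx A → Support A → Set₁
Entails F 𝓑 R G = ∀ 𝓧 → 𝓑 ⊆ 𝓧 → ∀ U → F 𝓧 U → G 𝓧 (R [ U ])

⟦_⟧ : Formula A → Support A
⟦ atom p ⟧       = atomS p
⟦ φ ∧ ψ  ⟧ 𝓑 S = ∀ 𝓧 → 𝓑 ⊆ 𝓧 → ∀ U p →
                   Entails (⟦ φ ⟧ ⨟ˢ ⟦ ψ ⟧) 𝓧 U (atomS p) → atomS p 𝓧 (U [ S ])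
⟦ φ ∗ ψ  ⟧ 𝓑 S = ∀ 𝓧 → 𝓑 ⊆ 𝓧 → ∀ U p →
                   Entails (⟦ φ ⟧ ⸴ˢ ⟦ ψ ⟧) 𝓧 U (atomS p) → atomS p 𝓧 (U [ S ])
⟦ φ ∨ ψ  ⟧ 𝓑 S = ∀ 𝓧 → 𝓑 ⊆ 𝓧 → ∀ U p →
                   Entails ⟦ φ ⟧ 𝓧 U (atomS p) → Entails ⟦ ψ ⟧ 𝓧 U (atomS p) →
                   atomS p 𝓧 (U [ S ])
⟦ φ ⇒ ψ  ⟧ 𝓑 S = Entails ⟦ φ ⟧ 𝓑 (S ⨟ʳ ○) ⟦ ψ ⟧
⟦ φ ─∗ ψ ⟧ 𝓑 S = Entails ⟦ φ ⟧ 𝓑 (S ⸴ʳ ○) ⟦ ψ ⟧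
⟦ ⊥      ⟧ 𝓑 S = ∀ U p → atomS p 𝓑 (U [ S ])
⟦ ⊤      ⟧ 𝓑 S = ∀ 𝓧 → 𝓑 ⊆ 𝓧 → ∀ U p →
                   atomS p 𝓧 (U [ ∅₊ ]) → atomS p 𝓧 (U [ S ])
⟦ ⊤*     ⟧ 𝓑 S = ∀ 𝓧 → 𝓑 ⊆ 𝓧 → ∀ U p →
                   atomS p 𝓧 (U [ ∅ₓ ]) → atomS p 𝓧 (U [ S ])

⟦_⟧ᵇ : Bunch (Formula A) → Support A
⟦ leaf φ ⟧ᵇ     = ⟦ φ ⟧
⟦ ∅ₓ     ⟧ᵇ 𝓑 S = Lift (suc 0ℓ) (S ⪰ ∅ₓ)
⟦ ∅₊     ⟧ᵇ 𝓑 S = Unit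
⟦ Γ ⸴ Δ  ⟧ᵇ     = ⟦ Γ ⟧ᵇ ⸴ˢ ⟦ Δ ⟧ᵇ
⟦ Γ ⨟ Δ  ⟧ᵇ     = ⟦ Γ ⟧ᵇ ⨟ˢ ⟦ Δ ⟧ᵇ

_⊩⟨_∣_⟩_ : Bunch (Formula A) → Base A → Ctx A → Formula A → Set₁
Γ ⊩⟨ 𝓑 ∣ R ⟩ ψ = Entails ⟦ Γ ⟧ᵇ 𝓑 R ⟦ ψ ⟧

_⊨_ : Bunch (Formula A) → Formula A → Set₁
Γ ⊨ φ = ∀ 𝓑 → Γ ⊩⟨ 𝓑 ∣ ○ ⟩ φ

-- The connective clauses in terms of support of sequents.
module _ {𝓑 : Base A} {S : Bunch A} {φ ψ : Formula A} where

  ∧-clause : ⟦ φ ∧ ψ ⟧ 𝓑 S ≡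
    (∀ 𝓧 → 𝓑 ⊆ 𝓧 → ∀ U p →
     leaf φ ⨟ leaf ψ ⊩⟨ 𝓧 ∣ U ⟩ atom p → ⟦ atom p ⟧ 𝓧 (U [ S ]))
  ∧-clause = refl

  ∗-clause : ⟦ φ ∗ ψ ⟧ 𝓑 S ≡
    (∀ 𝓧 → 𝓑 ⊆ 𝓧 → ∀ U p →
     leaf φ ⸴ leaf ψ ⊩⟨ 𝓧 ∣ U ⟩ atom p → ⟦ atom p ⟧ 𝓧 (U [ S ]))
  ∗-clause = refl

  ∨-clause : ⟦ φ ∨ ψ ⟧ 𝓑 S ≡
    (∀ 𝓧 → 𝓑 ⊆ 𝓧 → ∀ U p →
     leaf φ ⊩⟨ 𝓧 ∣ U ⟩ atom p → leaf ψ ⊩⟨ 𝓧 ∣ U ⟩ atom p →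
     ⟦ atom p ⟧ 𝓧 (U [ S ]))
  ∨-clause = refl

  ⇒-clause : ⟦ φ ⇒ ψ ⟧ 𝓑 S ≡ (leaf φ ⊩⟨ 𝓑 ∣ S ⨟ʳ ○ ⟩ ψ)
  ⇒-clause = refl

  ─∗-clause : ⟦ φ ─∗ ψ ⟧ 𝓑 S ≡ (leaf φ ⊩⟨ 𝓑 ∣ S ⸴ʳ ○ ⟩ ψ)
  ─∗-clause = refl

{-# OPTIONS --safe #-}

-- All clauses of support are continuation-style: to support a formula is to
-- pass every atomic test U(·), p that some class of resources passes.  Hence
-- if S passes all atomic tests passed by every resource in M ("M covers S"),
-- then S may replace the resources in M in support of an arbitrary formula
-- (`local`).  This single principle yields all elimination rules, and also
-- monotonicity of support along the observational preorder ⊒.  The latter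
-- contains contraction, which ⪰ does not, and which is needed to pull a
-- supported sub-bunch out of an additive context (`focus`).
module Submission where

open import Level using (Lift; lift; lower)
open import Data.Empty.Polymorphic using () renaming (⊥ to Empty)
open import Data.List.Relation.Unary.All using (All; []; _∷_)
open import Data.Nat.Base using (ℕ)
open import Data.Product.Base using (_×_; _,_; ∃-syntax)
open import Data.Sum.Base using (_⊎_; inj₁; inj₂)
open import Data.Unit.Polymorphic.Base using (tt)
open import Function.Base using (id; _∘_)
open import Function.Bundles using (_↔_)
open import Relation.Binary.Construct.Closure.Transitive
  using () renaming ([_] to single; _∷_ to _◅_; _++_ to _◅◅_)
open import Relation.Binary.PropositionalEquality.Core
  using (_≡_; refl; sym; cong; subst)
open import Relation.Unary using (_⊆_)
open import Defs

private variable
  A X : Set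
  𝓑 𝓧 : Base A
  S T Q Q′ : Bunch X

-- Contexts and bunch-extension

infixr 9 _⊚_

_⊚_ : Ctx X → Ctx X → Ctx X
○        ⊚ K = K
(C ⨟ˡ Δ) ⊚ K = (C ⊚ K) ⨟ˡ Δ
(C ⸴ˡ Δ) ⊚ K = (C ⊚ K) ⸴ˡ Δ
(Δ ⨟ʳ C) ⊚ K = Δ ⨟ʳ (C ⊚ K)
(Δ ⸴ʳ C) ⊚ K = Δ ⸴ʳ (C ⊚ K)

⊚-[] : ∀ (C K : Ctx X) Σ → (C ⊚ K) [ Σ ] ≡ C [ K [ Σ ] ]
⊚-[] ○        K Σ = refl
⊚-[] (C ⨟ˡ Δ) K Σ = cong (_⨟ Δ) (⊚-[] C K Σ)
⊚-[] (C ⸴ˡ Δ) K Σ = cong (_⸴ Δ) (⊚-[] C K Σ)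
⊚-[] (Δ ⨟ʳ C) K Σ = cong (Δ ⨟_) (⊚-[] C K Σ)
⊚-[] (Δ ⸴ʳ C) K Σ = cong (Δ ⸴_) (⊚-[] C K Σ)

≋⇒⪰ : S ≋ T → S ⪰ T
≋⇒⪰ {T = T} e = single (extend ○ T ∅₊ (≋-trans e (≋-sym ⨟-identityʳ)))

⪰-refl : S ⪰ S
⪰-refl = ≋⇒⪰ ≋-refl

⪰₁-cong : ∀ (C : Ctx X) → S ⪰₁ T → C [ S ] ⪰₁ C [ T ]
⪰₁-cong C (extend {Γ} K Δ Δ′ e) =
  subst (C [ Γ ] ⪰₁_) (⊚-[] C K Δ)
    (extend (C ⊚ K) Δ Δ′
      (subst (C [ Γ ] ≋_) (sym (⊚-[] C K (Δ ⨟ Δ′))) (≋-cong C e)))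

⪰-cong : ∀ (C : Ctx X) → S ⪰ T → C [ S ] ⪰ C [ T ]
⪰-cong C (single s) = single (⪰₁-cong C s)
⪰-cong C (s ◅ ss)   = ⪰₁-cong C s ◅ ⪰-cong C ss

⸴-mono-⪰ : ∀ {S S′ T T′ : Bunch X} → S ⪰ S′ → T ⪰ T′ → (S ⸴ T) ⪰ (S′ ⸴ T′)
⸴-mono-⪰ {S′ = S′} {T} s t = ⪰-cong (○ ⸴ˡ T) s ◅◅ ⪰-cong (S′ ⸴ʳ ○) t

⨟-⪰ˡ : (S ⨟ T) ⪰ S
⨟-⪰ˡ = single (extend ○ _ _ ≋-refl)

⨟-⪰ʳ : (S ⨟ T) ⪰ T
⨟-⪰ʳ = single (extend ○ _ _ ⨟-comm)

-- The observational preorder on atomic bunches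

infix 2 _⊒_

-- Ranging over all bases makes the relation stable under base extension, and ranging over all
-- contexts makes it a congruence.
_⊒_ : Bunch A → Bunch A → Set₁
_⊒_ {A} S Q =
  ∀ {𝓑 : Base A} U p → ⟨ 𝓑 ⟩ U [ Q ] ⊢ₐ p → ⟨ 𝓑 ⟩ U [ S ] ⊢ₐ p

⊒-trans : S ⊒ T → T ⊒ Q → S ⊒ Q
⊒-trans s t U p = s U p ∘ t U p

⊒-cong : ∀ (C : Ctx A) → S ⊒ T → C [ S ] ⊒ C [ T ]
⊒-cong {S = S} {T} C s {𝓑} U p d =
  subst (⟨ 𝓑 ⟩_⊢ₐ p) (⊚-[] U C S)
    (s (U ⊚ C) p (subst (⟨ 𝓑 ⟩_⊢ₐ p) (sym (⊚-[] U C T)) d))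

⪰₁⇒⊒ : S ⪰₁ T → S ⊒ T
⪰₁⇒⊒ (extend C Δ Δ′ e) U p d =
  exch U (⊒-cong {S = Δ ⨟ Δ′} {Δ} C (λ V q → weak V) U p d) (≋-sym e)

⪰⇒⊒ : S ⪰ T → S ⊒ T
⪰⇒⊒ (single s)         = ⪰₁⇒⊒ s
⪰⇒⊒ {T = T} (s ◅ ss) U p = ⪰₁⇒⊒ s U p ∘ ⪰⇒⊒ {T = T} ss U p

-- Trade `Q′` and then `Q` for `S`, and contract the resulting `S ⨟ S`.
⊒-⨟ : S ⊒ Q → S ⊒ Q′ → S ⊒ (Q ⨟ Q′)
⊒-⨟ {S = S} {Q} {Q′} s s′ U p d =
  cont U (⊒-cong {S = S} {Q} (○ ⨟ˡ S) s U p
         (⊒-cong {S = S} {Q′} (Q ⨟ʳ ○) s′ U p d))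

-- Monotonicity and locality of support

⊢ₐ-mono : ∀ {p} → 𝓑 ⊆ 𝓧 → ⟨ 𝓑 ⟩ S ⊢ₐ p → ⟨ 𝓧 ⟩ S ⊢ₐ p
⊢ₐ-mono {𝓑 = 𝓑} {𝓧} i = go
  where
  open Sequent
  go     : ∀ {S p} → ⟨ 𝓑 ⟩ S ⊢ₐ p → ⟨ 𝓧 ⟩ S ⊢ₐ p
  go-all : ∀ {ss} → All (λ s → ⟨ 𝓑 ⟩ antecedent s ⊢ₐ succedent s) ss →
                    All (λ s → ⟨ 𝓧 ⟩ antecedent s ⊢ₐ succedent s) ss
  go taut        = taut
  go (app r ds)  = app (i r) (go-all ds)
  go (weak C d)   = weak C (go d)
  go (cont C d)   = cont C (go d)
  go (exch C d e) = exch C (go d) e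
  go (cut C d d′) = cut C (go d) (go d′)
  go-all []       = []
  go-all (d ∷ ds) = go d ∷ go-all ds

-- Most clauses already quantify over larger bases. Atoms and `⊥` speak of one fixed base and fall
-- back on derivability.
⟦⟧-base : ∀ (φ : Formula A) → 𝓑 ⊆ 𝓧 → ⟦ φ ⟧ 𝓑 S → ⟦ φ ⟧ 𝓧 S
⟦⟧-base (atom p) i s         = lift (⊢ₐ-mono i (lower s))
⟦⟧-base ⊤        i s 𝓨 j     = s 𝓨 (j ∘ i)
⟦⟧-base ⊥        i s U p     = lift (⊢ₐ-mono i (lower (s U p)))
⟦⟧-base ⊤*       i s 𝓨 j     = s 𝓨 (j ∘ i)
⟦⟧-base (φ ∧ ψ)  i s 𝓨 j     = s 𝓨 (j ∘ i)
⟦⟧-base (φ ∨ ψ)  i s 𝓨 j     = s 𝓨 (j ∘ i)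
⟦⟧-base (φ ⇒ ψ)  i s 𝓨 j     = s 𝓨 (j ∘ i)
⟦⟧-base (φ ∗ ψ)  i s 𝓨 j     = s 𝓨 (j ∘ i)
⟦⟧-base (φ ─∗ ψ) i s 𝓨 j     = s 𝓨 (j ∘ i)

-- The common shape of the clauses: `⟦ φ ∧ ψ ⟧` and `⟦ φ ∗ ψ ⟧` are definitionally instances, with
-- `M` the support of the corresponding two-leaf bunch.
Covers : Support A → Support A
Covers M 𝓑 S =
  ∀ 𝓧 → 𝓑 ⊆ 𝓧 → ∀ U p → Entails M 𝓧 U (atomS p) → atomS p 𝓧 (U [ S ])

Only : Bunch A → Support A
Only Q 𝓑 S = Lift _ (S ≡ Q)

_∪ˢ_ : Support A → Support A → Support A
(F ∪ˢ G) 𝓑 S = F 𝓑 S ⊎ G 𝓑 S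

module _ {M : Support A} where

  covers-under : ∀ U → Covers M 𝓑 S → 𝓑 ⊆ 𝓧 → ∀ V p →
    (∀ 𝓨 → 𝓧 ⊆ 𝓨 → ∀ W → M 𝓨 W → atomS p 𝓨 (V [ U [ W ] ])) →
    atomS p 𝓧 (V [ U [ S ] ])
  covers-under {S = S} {𝓧 = 𝓧} U c i V p t =
    subst (atomS p 𝓧) (⊚-[] V U S)
      (c 𝓧 i (V ⊚ U) p λ 𝓨 j W m →
        subst (atomS p 𝓨) (sym (⊚-[] V U W)) (t 𝓨 j W m))

  -- Induction on `χ`. A clause made of atomic tests in a context `V` becomes a test of `S` in
  -- `V ⊚ U`, which each member of `M` passes by hypothesis.
  local : ∀ χ U → Covers M 𝓑 S → Entails M 𝓑 U ⟦ χ ⟧ → ⟦ χ ⟧ 𝓑 (U [ S ])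
  local (atom p) U c e = c _ id U p e
  local ⊤ U c e 𝓧 i V p k = covers-under U c i V p λ 𝓨 j W m →
    e 𝓨 (j ∘ i) W m 𝓨 id V p (⟦⟧-base (atom p) j k)
  local ⊥ U c e V p = covers-under U c id V p λ 𝓨 j W m →
    e 𝓨 j W m V p
  local ⊤* U c e 𝓧 i V p k = covers-under U c i V p λ 𝓨 j W m →
    e 𝓨 (j ∘ i) W m 𝓨 id V p (⟦⟧-base (atom p) j k)
  local (φ ∧ ψ) U c e 𝓧 i V p k = covers-under U c i V p λ 𝓨 j W m →
    e 𝓨 (j ∘ i) W m 𝓨 id V p (λ 𝓩 l → k 𝓩 (l ∘ j))
  local (φ ∨ ψ) U c e 𝓧 i V p k k′ = covers-under U c i V p λ 𝓨 j W m →
    e 𝓨 (j ∘ i) W m 𝓨 id V p (λ 𝓩 l → k 𝓩 (l ∘ j)) (λ 𝓩 l → k′ 𝓩 (l ∘ j))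
  local (φ ∗ ψ) U c e 𝓧 i V p k = covers-under U c i V p λ 𝓨 j W m →
    e 𝓨 (j ∘ i) W m 𝓨 id V p (λ 𝓩 l → k 𝓩 (l ∘ j))
  -- The argument `V` of an implication is absorbed into the context, and the induction continues at
  -- `ψ`.
  local (φ ⇒ ψ) U c e 𝓧 i V s =
    local ψ (U ⨟ˡ V) (λ 𝓨 j → c 𝓨 (j ∘ i)) λ 𝓨 j W m →
      e 𝓨 (j ∘ i) W m 𝓨 id V (⟦⟧-base φ j s)
  local (φ ─∗ ψ) U c e 𝓧 i V s =
    local ψ (U ⸴ˡ V) (λ 𝓨 j → c 𝓨 (j ∘ i)) λ 𝓨 j W m →
      e 𝓨 (j ∘ i) W m 𝓨 id V (⟦⟧-base φ j s)

⊤-covers : ⟦ ⊤ ⟧ 𝓑 S → Covers (Only ∅₊) 𝓑 S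
⊤-covers s 𝓧 i U p k = s 𝓧 i U p (k 𝓧 id ∅₊ (lift refl))

⊤*-covers : ⟦ ⊤* ⟧ 𝓑 S → Covers (Only ∅ₓ) 𝓑 S
⊤*-covers s 𝓧 i U p k = s 𝓧 i U p (k 𝓧 id ∅ₓ (lift refl))

-- Passing every test outright amounts to covering the empty class.
⊥-covers : ⟦ ⊥ ⟧ 𝓑 S → Covers (λ _ _ → Empty) 𝓑 S
⊥-covers s 𝓧 i U p _ = ⟦⟧-base (atom p) i (s U p)

∨-covers : ∀ (φ ψ : Formula A) →
  ⟦ φ ∨ ψ ⟧ 𝓑 S → Covers (⟦ φ ⟧ ∪ˢ ⟦ ψ ⟧) 𝓑 S
∨-covers φ ψ s 𝓧 i U p k =
  s 𝓧 i U p (λ 𝓨 j W m → k 𝓨 j W (inj₁ m)) (λ 𝓨 j W m → k 𝓨 j W (inj₂ m))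

-- `S ⊒ Q` makes `S` cover the singleton class of `Q`.
⟦⟧-⊒ : ∀ (φ : Formula A) → S ⊒ Q → ⟦ φ ⟧ 𝓑 Q → ⟦ φ ⟧ 𝓑 S
⟦⟧-⊒ {Q = Q} φ s q = local {M = Only Q} φ ○
  (λ 𝓧 i U p k → lift (s U p (lower (k 𝓧 id Q (lift refl)))))
  λ { 𝓧 i _ (lift refl) → ⟦⟧-base φ i q }

-- Support of bunches

⟦⟧ᵇ-base : ∀ (Γ : Bunch (Formula A)) → 𝓑 ⊆ 𝓧 → ⟦ Γ ⟧ᵇ 𝓑 S → ⟦ Γ ⟧ᵇ 𝓧 S
⟦⟧ᵇ-base (leaf φ) i s = ⟦⟧-base φ i s
⟦⟧ᵇ-base ∅₊       i s = tt
⟦⟧ᵇ-base ∅ₓ       i s = s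
⟦⟧ᵇ-base (Γ ⨟ Δ)  i (Q₁ , Q₂ , e₁ , e₂ , s₁ , s₂) =
  Q₁ , Q₂ , e₁ , e₂ , ⟦⟧ᵇ-base Γ i s₁ , ⟦⟧ᵇ-base Δ i s₂
⟦⟧ᵇ-base (Γ ⸴ Δ)  i (Q₁ , Q₂ , e , s₁ , s₂) =
  Q₁ , Q₂ , e , ⟦⟧ᵇ-base Γ i s₁ , ⟦⟧ᵇ-base Δ i s₂

-- Stated for `⪰` and not `⊒`, since the structural clauses themselves are phrased with `⪰`.
⟦⟧ᵇ-⪰ : ∀ (Γ : Bunch (Formula A)) → S ⪰ T → ⟦ Γ ⟧ᵇ 𝓑 T → ⟦ Γ ⟧ᵇ 𝓑 S
⟦⟧ᵇ-⪰ {T = T} (leaf φ) h s = ⟦⟧-⊒ φ (⪰⇒⊒ {T = T} h) s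
⟦⟧ᵇ-⪰ ∅₊       h s        = tt
⟦⟧ᵇ-⪰ ∅ₓ       h (lift e) = lift (h ◅◅ e)
⟦⟧ᵇ-⪰ (Γ ⨟ Δ)  h (Q₁ , Q₂ , e₁ , e₂ , ss) = Q₁ , Q₂ , h ◅◅ e₁ , h ◅◅ e₂ , ss
⟦⟧ᵇ-⪰ (Γ ⸴ Δ)  h (Q₁ , Q₂ , e , ss)       = Q₁ , Q₂ , h ◅◅ e , ss

⟦⟧ᵇ-map : ∀ (C : Ctx (Formula A)) {Δ Δ′} →
  (∀ {Q} → ⟦ Δ ⟧ᵇ 𝓑 Q → ⟦ Δ′ ⟧ᵇ 𝓑 Q) → ⟦ C [ Δ ] ⟧ᵇ 𝓑 S → ⟦ C [ Δ′ ] ⟧ᵇ 𝓑 S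
⟦⟧ᵇ-map ○ f s = f s
⟦⟧ᵇ-map (C ⨟ˡ Γ) f (Q₁ , Q₂ , e₁ , e₂ , s₁ , s₂) =
  Q₁ , Q₂ , e₁ , e₂ , ⟦⟧ᵇ-map C f s₁ , s₂
⟦⟧ᵇ-map (C ⸴ˡ Γ) f (Q₁ , Q₂ , e , s₁ , s₂) = Q₁ , Q₂ , e , ⟦⟧ᵇ-map C f s₁ , s₂
⟦⟧ᵇ-map (Γ ⨟ʳ C) f (Q₁ , Q₂ , e₁ , e₂ , s₁ , s₂) =
  Q₁ , Q₂ , e₁ , e₂ , s₁ , ⟦⟧ᵇ-map C f s₂
⟦⟧ᵇ-map (Γ ⸴ʳ C) f (Q₁ , Q₂ , e , s₁ , s₂) = Q₁ , Q₂ , e , s₁ , ⟦⟧ᵇ-map C f s₂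

-- Symmetry is a constructor of `≋`, so both directions are proved by mutual recursion.
⟦⟧ᵇ-≋  : ∀ {Γ Δ : Bunch (Formula A)} → Γ ≋ Δ → ⟦ Γ ⟧ᵇ 𝓑 S → ⟦ Δ ⟧ᵇ 𝓑 S
⟦⟧ᵇ-≋˘ : ∀ {Γ Δ : Bunch (Formula A)} → Γ ≋ Δ → ⟦ Δ ⟧ᵇ 𝓑 S → ⟦ Γ ⟧ᵇ 𝓑 S

⟦⟧ᵇ-≋ ≋-refl s = s
⟦⟧ᵇ-≋ (≋-sym e) s = ⟦⟧ᵇ-≋˘ e s
⟦⟧ᵇ-≋ (≋-trans e f) s = ⟦⟧ᵇ-≋ f (⟦⟧ᵇ-≋ e s)
-- Additive components share their resource, so `S` itself witnesses the regrouped one.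
⟦⟧ᵇ-≋ ⨟-assoc (_ , Q₃ , e , e₃ , (Q₁ , Q₂ , e₁ , e₂ , s₁ , s₂) , s₃) =
  Q₁ , _ , e ◅◅ e₁ , ⪰-refl , s₁ , (Q₂ , Q₃ , e ◅◅ e₂ , e₃ , s₂ , s₃)
⟦⟧ᵇ-≋ ⨟-comm (Q₁ , Q₂ , e₁ , e₂ , s₁ , s₂) = Q₂ , Q₁ , e₂ , e₁ , s₂ , s₁
⟦⟧ᵇ-≋ {Γ = Γ ⨟ _} ⨟-identityʳ (Q₁ , _ , e , _ , s , _) = ⟦⟧ᵇ-⪰ Γ e s
⟦⟧ᵇ-≋ ⸴-assoc (_ , Q₃ , e , (Q₁ , Q₂ , e′ , s₁ , s₂) , s₃) =
  Q₁ , (Q₂ ⸴ Q₃) , e ◅◅ ⸴-mono-⪰ e′ ⪰-refl ◅◅ ≋⇒⪰ ⸴-assoc , s₁ ,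
  (Q₂ , Q₃ , ⪰-refl , s₂ , s₃)
⟦⟧ᵇ-≋ ⸴-comm (Q₁ , Q₂ , e , s₁ , s₂) = Q₂ , Q₁ , e ◅◅ ≋⇒⪰ ⸴-comm , s₂ , s₁
⟦⟧ᵇ-≋ {Γ = Γ ⸴ _} ⸴-identityʳ (Q₁ , Q₂ , e , s , lift u) =
  ⟦⟧ᵇ-⪰ Γ (e ◅◅ ⸴-mono-⪰ ⪰-refl u ◅◅ ≋⇒⪰ ⸴-identityʳ) s
⟦⟧ᵇ-≋ (≋-cong C e) s = ⟦⟧ᵇ-map C (⟦⟧ᵇ-≋ e) s

⟦⟧ᵇ-≋˘ ≋-refl s = s
⟦⟧ᵇ-≋˘ (≋-sym e) s = ⟦⟧ᵇ-≋ e s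
⟦⟧ᵇ-≋˘ (≋-trans e f) s = ⟦⟧ᵇ-≋˘ e (⟦⟧ᵇ-≋˘ f s)
⟦⟧ᵇ-≋˘ ⨟-assoc (Q₁ , _ , e₁ , e , s₁ , (Q₂ , Q₃ , e₂ , e₃ , s₂ , s₃)) =
  _ , Q₃ , ⪰-refl , e ◅◅ e₃ , (Q₁ , Q₂ , e₁ , e ◅◅ e₂ , s₁ , s₂) , s₃
⟦⟧ᵇ-≋˘ ⨟-comm (Q₁ , Q₂ , e₁ , e₂ , s₁ , s₂) = Q₂ , Q₁ , e₂ , e₁ , s₂ , s₁
⟦⟧ᵇ-≋˘ ⨟-identityʳ s = _ , ∅₊ , ⪰-refl , ≋⇒⪰ (≋-sym ⨟-identityʳ) ◅◅ ⨟-⪰ʳ , s , tt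
⟦⟧ᵇ-≋˘ ⸴-assoc (Q₁ , _ , e , s₁ , (Q₂ , Q₃ , e′ , s₂ , s₃)) =
  (Q₁ ⸴ Q₂) , Q₃ , e ◅◅ ⸴-mono-⪰ ⪰-refl e′ ◅◅ ≋⇒⪰ (≋-sym ⸴-assoc) ,
  (Q₁ , Q₂ , ⪰-refl , s₁ , s₂) , s₃
⟦⟧ᵇ-≋˘ ⸴-comm (Q₁ , Q₂ , e , s₁ , s₂) = Q₂ , Q₁ , e ◅◅ ≋⇒⪰ ⸴-comm , s₂ , s₁
⟦⟧ᵇ-≋˘ ⸴-identityʳ s = _ , ∅ₓ , ≋⇒⪰ (≋-sym ⸴-identityʳ) , s , lift ⪰-refl
⟦⟧ᵇ-≋˘ (≋-cong C e) s = ⟦⟧ᵇ-map C (⟦⟧ᵇ-≋˘ e) s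

-- `K` is an atomic copy of `C` whose side bunches support those of `C`; the last component lets the
-- hole be refilled, also in larger bases.
Focus : Ctx (Formula A) → Bunch (Formula A) → Base A → Bunch A → Set₁
Focus C Δ 𝓑 S = ∃[ K ] ∃[ Q ] (S ⊒ K [ Q ]) × ⟦ Δ ⟧ᵇ 𝓑 Q ×
  (∀ Δ′ → Entails ⟦ Δ′ ⟧ᵇ 𝓑 K ⟦ C [ Δ′ ] ⟧ᵇ)

focus : ∀ C {Δ : Bunch (Formula A)} → ⟦ C [ Δ ] ⟧ᵇ 𝓑 S → Focus C Δ 𝓑 S
focus ○ s = ○ , _ , (λ U p d → d) , s , λ Δ′ 𝓧 i U s′ → s′
focus (C ⨟ˡ Γ) (Q₁ , Q₂ , e₁ , e₂ , s₁ , s₂) with focus C s₁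
... | K , Q , h , q , k =
  (K ⨟ˡ Q₂) , Q ,
  -- `S` extends `Q₁` and `Q₂` only separately; contraction joins them.
  ⊒-⨟ (⊒-trans (⪰⇒⊒ e₁) h) (⪰⇒⊒ e₂) , q ,
  λ Δ′ 𝓧 i U s′ → K [ U ] , Q₂ , ⨟-⪰ˡ , ⨟-⪰ʳ , k Δ′ 𝓧 i U s′ , ⟦⟧ᵇ-base Γ i s₂
focus (C ⸴ˡ Γ) (Q₁ , Q₂ , e , s₁ , s₂) with focus C s₁
... | K , Q , h , q , k =
  (K ⸴ˡ Q₂) , Q ,
  ⊒-trans (⪰⇒⊒ e) (⊒-cong (○ ⸴ˡ Q₂) h) , q ,
  λ Δ′ 𝓧 i U s′ → K [ U ] , Q₂ , ⪰-refl , k Δ′ 𝓧 i U s′ , ⟦⟧ᵇ-base Γ i s₂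
focus (Γ ⨟ʳ C) (Q₁ , Q₂ , e₁ , e₂ , s₁ , s₂) with focus C s₂
... | K , Q , h , q , k =
  (Q₁ ⨟ʳ K) , Q ,
  ⊒-⨟ (⪰⇒⊒ e₁) (⊒-trans (⪰⇒⊒ e₂) h) , q ,
  λ Δ′ 𝓧 i U s′ → Q₁ , K [ U ] , ⨟-⪰ˡ , ⨟-⪰ʳ , ⟦⟧ᵇ-base Γ i s₁ , k Δ′ 𝓧 i U s′
focus (Γ ⸴ʳ C) (Q₁ , Q₂ , e , s₁ , s₂) with focus C s₂
... | K , Q , h , q , k =
  (Q₁ ⸴ʳ K) , Q ,
  ⊒-trans (⪰⇒⊒ e) (⊒-cong (Q₁ ⸴ʳ ○) h) , q ,
  λ Δ′ 𝓧 i U s′ → Q₁ , K [ U ] , ⪰-refl , ⟦⟧ᵇ-base Γ i s₁ , k Δ′ 𝓧 i U s′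

-- Soundness

infix 1 _⊩_

_⊩_ : Bunch (Formula A) → Formula A → Set₁
_⊩_ {A} Γ φ = ∀ {𝓑 : Base A} {S} → ⟦ Γ ⟧ᵇ 𝓑 S → ⟦ φ ⟧ 𝓑 S

-- `focus` reduces `S` to `K [ Q ]`, and `local` then replaces `Q` by members of `M`. Letting `Δ′`
-- depend on the member accommodates the two cases of `∨E`.
eliminate : ∀ C {Δ : Bunch (Formula A)} χ {M : Support A} →
  (∀ {𝓑 Q} → ⟦ Δ ⟧ᵇ 𝓑 Q → Covers M 𝓑 Q) →
  (∀ {𝓑 Q} → M 𝓑 Q → ∃[ Δ′ ] (⟦ Δ′ ⟧ᵇ 𝓑 Q × (C [ Δ′ ] ⊩ χ))) →
  C [ Δ ] ⊩ χ
eliminate C χ c f s with focus C s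
... | K , Q , h , q , k = ⟦⟧-⊒ χ h (local χ K (c q) λ 𝓧 i U m →
  let Δ′ , s′ , d = f m in d (k Δ′ 𝓧 i U s′))

sound : ∀ {Γ : Bunch (Formula A)} {φ} → Γ ⊢ φ → Γ ⊩ φ
sound ax s = s
sound (ex e d) s = sound d (⟦⟧ᵇ-≋ e s)
sound (wk C {Δ} d) s =
  sound d (⟦⟧ᵇ-map C (λ { (_ , _ , e , _ , q , _) → ⟦⟧ᵇ-⪰ Δ e q }) s)
-- Support of `Δ ⨟ Δ` may use one resource twice.
sound (ct C d) s =
  sound d (⟦⟧ᵇ-map C (λ q → _ , _ , ⪰-refl , ⪰-refl , q , q) s)
sound ⊤*I (lift e) 𝓧 i U p (lift k) = lift (⪰⇒⊒ e U p k)
sound (⊤*E C {χ = χ} d d′) = eliminate C χ (λ q → ⊤*-covers (sound d′ q))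
  λ { (lift refl) → ∅ₓ , lift ⪰-refl , sound d }
sound (─∗I {Γ} d) s 𝓧 i U m = sound d (_ , U , ⪰-refl , ⟦⟧ᵇ-base Γ i s , m)
sound (─∗E {ψ = ψ} d d′) (Q₁ , Q₂ , e , s₁ , s₂) =
  ⟦⟧-⊒ ψ (⪰⇒⊒ e) (sound d s₁ _ id Q₂ (sound d′ s₂))
sound (∗I {φ = φ} {ψ} d d′) (Q₁ , Q₂ , e , s₁ , s₂) 𝓧 i U p k =
  k 𝓧 id _ (Q₁ , Q₂ , e , ⟦⟧-base φ i (sound d s₁) , ⟦⟧-base ψ i (sound d′ s₂))
sound (∗E C {χ = χ} d d′) = eliminate C χ (λ q → sound d′ q) λ m → _ , m , sound d
sound ⊤I s 𝓧 i U p (lift k) =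
  lift (⪰⇒⊒ (≋⇒⪰ (≋-sym ⨟-identityʳ) ◅◅ ⨟-⪰ʳ) U p k)
sound (⊤E C {χ = χ} d d′) = eliminate C χ (λ q → ⊤-covers (sound d′ q))
  λ _ → ∅₊ , tt , sound d
sound (⇒I {Γ} d) s 𝓧 i U m =
  sound d (_ , U , ⨟-⪰ˡ , ⨟-⪰ʳ , ⟦⟧ᵇ-base Γ i s , m)
-- The premisses give `ψ` at `Q₁ ⨟ Q₂`; reaching `S` takes contraction.
sound (⇒E {ψ = ψ} d d′) (Q₁ , Q₂ , e₁ , e₂ , s₁ , s₂) =
  ⟦⟧-⊒ ψ (⊒-⨟ (⪰⇒⊒ e₁) (⪰⇒⊒ e₂)) (sound d s₁ _ id Q₂ (sound d′ s₂))
sound (∧I {φ = φ} {ψ} d d′) (Q₁ , Q₂ , e₁ , e₂ , s₁ , s₂) 𝓧 i U p k =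
  k 𝓧 id _ (Q₁ , Q₂ , e₁ , e₂ ,
             ⟦⟧-base φ i (sound d s₁) , ⟦⟧-base ψ i (sound d′ s₂))
sound (∧E C {χ = χ} d d′) = eliminate C χ (λ q → sound d′ q) λ m → _ , m , sound d
sound (∨I₁ {φ = φ} d) s 𝓧 i U p k k′ = k 𝓧 id _ (⟦⟧-base φ i (sound d s))
sound (∨I₂ {ψ = ψ} d) s 𝓧 i U p k k′ = k′ 𝓧 id _ (⟦⟧-base ψ i (sound d s))
sound (∨E C {φ = φ} {ψ} {χ} d₁ d₂ d′) =
  eliminate C χ (λ q → ∨-covers φ ψ (sound d′ q))
    λ { (inj₁ m) → leaf φ , m , sound d₁ ; (inj₂ m) → leaf ψ , m , sound d₂ }
sound (⊥E {φ = φ} d) s = local φ ○ (⊥-covers (sound d s)) λ _ _ _ ()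

theorem5p1 : (𝔸 : Set) → 𝔸 ↔ ℕ → (Γ : Bunch (Formula 𝔸)) (φ : Formula 𝔸) → Γ ⊢ φ → Γ ⊨ φ
theorem5p1 𝔸 _ Γ φ d 𝓑 𝓧 _ U s = sound d s
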